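{- Every word of length $18$ over the binary alphabet $\{a,b\}$ that does not contain the factor $bb$ contains an abelian $4$-power. This bound is tight: the word $babaaabaaabaaabab$ of length $17$ does not contain the factor $bb$ and does not contain an abelian $4$-power.
   Context: A factor of a word is a contiguous subword. A word contains an abelian $k$-power if it has a factor of the form $v_1v_2\cdots v_k$ where $v_1,\dots,v_k$ are non-empty words that are permutations (anagrams) of one another. -}

module Defs where

open import Data.Fin.Base using (Fin)
open import Data.List.Base using (List; []; _∷_; concat; tabulate)
open import Data.List.Relation.Binary.Infix.Heterogeneous using (Infix)
open import Data.List.Relation.Binary.Permutation.Propositional using (_↭_)
open import Data.Nat.Base using (ℕ)
open import Data.Product.Base using (_×_; ∃-syntax)
open import Relation.Binary.PropositionalEquality.Core using (_≡_; _≢_)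

data Letter : Set where
  a b : Letter

Word : Set
Word = List Letter

infix 4 _IsFactorOf_

_IsFactorOf_ : Word → Word → Set
u IsFactorOf w = Infix _≡_ u w

-- The factor is v₁v₂⋯vₖ, where vᵢ₊₁ is the value of v at i : Fin k.
ContainsAbelianPower : ℕ → Word → Set
ContainsAbelianPower k w =
  ∃[ v ] (∀ (i : Fin k) → v i ≢ [])
       × (∀ (i j : Fin k) → v i ↭ v j)
       × concat (tabulate v) IsFactorOf w

bb : Word
bb = b ∷ b ∷ []

-- babaaabaaabaaabab
extremalWord : Word
extremalWord =
  b ∷ a ∷ b ∷ a ∷ a ∷ a ∷ b ∷ a ∷ a ∷ a ∷ b ∷ a ∷ a ∷ a ∷ b ∷ a ∷ b ∷ []

{-# OPTIONS --safe #-}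
-- Whether a word starts with bb or with an abelian 4-power is decidable.
-- Extending words to the left letter by letter and pruning as soon as the
-- current word starts with such a forbidden factor, the search tree has
-- only about 700 nodes and every branch is pruned by depth 18; the
-- extremal word is settled by inspecting each of its suffixes.
module Submission where

open import Defs
open import Data.Fin.Base using (Fin; zero; suc)
open import Data.List.Base
  using (List; []; _∷_; _++_; _ʳ++_; concat; tabulate; length; filter;
         replicate; take; drop; reverse; tails)
open import Data.List.Properties
  using (take++drop≡id; length-take; ʳ++-defn; ++-identityʳ; reverse-involutive; length-reverse)
open import Data.List.Relation.Binary.Infix.Heterogeneous using (Infix; here; there)
open import Data.List.Relation.Binary.Infix.Heterogeneous.Properties using (infix?)
open import Data.List.Relation.Binary.Permutation.Propositional
  using (_↭_; ↭-refl; ↭-sym; ↭-trans; ↭-reflexive; ↭-prep)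
open import Data.List.Relation.Binary.Permutation.Propositional.Properties
  using (↭-length; filter-↭; shift; ↭-empty-inv)
open import Data.List.Relation.Binary.Prefix.Heterogeneous using (Prefix; []; _∷_)
open import Data.List.Relation.Binary.Prefix.Heterogeneous.Properties using (prefix?)
open import Data.List.Relation.Unary.Any as Any using (Any; here; there; any?)
open import Data.List.Relation.Unary.Any.Properties using (Any-⊎⁻)
open import Data.Nat.Base using (ℕ; zero; suc; _<_)
open import Data.Nat.Properties as ℕ using (anyUpTo?; suc-injective)
open import Data.Product.Base using (_×_; _,_; proj₁; ∃-syntax)
open import Data.Sum.Base using (_⊎_; inj₁; inj₂)
open import Data.Unit.Base using (⊤; tt)
open import Data.Vec.Functional as Vector using ()
open import Level using (0ℓ)
open import Relation.Binary.Definitions using (DecidableEquality)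
open import Relation.Binary.PropositionalEquality
  using (_≡_; _≢_; refl; sym; trans; cong; cong₂; subst)
open import Relation.Nullary using (¬_; Dec; yes; no; contradiction)
open import Relation.Nullary.Decidable using (map′; from-yes; from-no; _×-dec_; _⊎-dec_)
open import Relation.Unary using (Pred; Decidable)

infix 4 _≟_ _↭?_

_≟_ : DecidableEquality Letter
a ≟ a = yes refl
a ≟ b = no λ ()
b ≟ a = no λ ()
b ≟ b = yes refl

count : Letter → Word → ℕ
count x w = length (filter (_≟ x) w)

-- The sorted word is a normal form for `↭`, and over two letters it depends only on the two counts.
-- Deciding `↭` thus reduces to comparing two pairs of numbers.
↭-sorted : ∀ w → w ↭ replicate (count a w) a ++ replicate (count b w) b
↭-sorted []      = ↭-refl
↭-sorted (a ∷ w) = ↭-prep a (↭-sorted w)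
↭-sorted (b ∷ w) =
  ↭-trans (↭-prep b (↭-sorted w)) (↭-sym (shift b (replicate (count a w) a) _))

_↭?_ : ∀ (u v : Word) → Dec (u ↭ v)
u ↭? v = map′ to from (count a u ℕ.≟ count a v ×-dec count b u ℕ.≟ count b v)
  where
  to : count a u ≡ count a v × count b u ≡ count b v → u ↭ v
  to (eqa , eqb) = ↭-trans (↭-sorted u) (↭-trans
    (↭-reflexive (cong₂ (λ m n → replicate m a ++ replicate n b) eqa eqb))
    (↭-sym (↭-sorted v)))

  from : u ↭ v → count a u ≡ count a v × count b u ≡ count b v
  from u↭v = ↭-length (filter-↭ (_≟ a) u↭v) , ↭-length (filter-↭ (_≟ b) u↭v)

module _ {A : Set} where

  Prefix-++⁺ : ∀ (xs : List A) {ys zs} →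
               Prefix _≡_ ys zs → Prefix _≡_ (xs ++ ys) (xs ++ zs)
  Prefix-++⁺ []       p = p
  Prefix-++⁺ (x ∷ xs) p = refl ∷ Prefix-++⁺ xs p

  Prefix-++⁻ : ∀ (xs : List A) {ys zs} → Prefix _≡_ (xs ++ ys) zs →
               take (length xs) zs ≡ xs × Prefix _≡_ ys (drop (length xs) zs)
  Prefix-++⁻ []       p          = refl , p
  Prefix-++⁻ (x ∷ xs) (refl ∷ p) with Prefix-++⁻ xs p
  ... | eq , q = cong (x ∷_) eq , q

  Infix⇒Any-Prefix-tails : ∀ {xs ys : List A} →
                           Infix _≡_ xs ys → Any (Prefix _≡_ xs) (tails ys)
  Infix⇒Any-Prefix-tails (here p)  = here p
  Infix⇒Any-Prefix-tails (there i) = there (Infix⇒Any-Prefix-tails i)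

  -- The suffix itself is returned with a map from its prefixes to infixes of `xs`, so that the same
  -- lemma serves both for `bb` and for a power whose blocks are known only after `P ys` is
  -- unpacked.
  Any-tails⇒Infix : ∀ {P : Pred (List A) 0ℓ} {xs : List A} → Any P (tails xs) →
                    ∃[ ys ] P ys × (∀ {us} → Prefix _≡_ us ys → Infix _≡_ us xs)
  Any-tails⇒Infix {xs = xs}    (here px)  = xs , px , here
  Any-tails⇒Infix {xs = x ∷ _} (there ps) with Any-tails⇒Infix ps
  ... | ys , py , inf = ys , py , λ p → there (inf p)

  Any-tails-ʳ++ : ∀ {P : Pred (List A) 0ℓ} xs {ys} →
                  Any P (tails ys) → Any P (tails (xs ʳ++ ys))
  Any-tails-ʳ++ []       p = p
  Any-tails-ʳ++ (x ∷ xs) p = Any-tails-ʳ++ xs (there p)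

-- Permutations of `u` all have its length, so the cuts between blocks are forced and no search over
-- `v` remains. If `w` is too short, `take` returns fewer letters than `u` has and the permutation
-- fails.
StartsWithBlocks : ℕ → Word → Word → Set
StartsWithBlocks zero    u w = ⊤
StartsWithBlocks (suc k) u w =
  take (length u) w ↭ u × StartsWithBlocks k u (drop (length u) w)

startsWithBlocks? : ∀ k u w → Dec (StartsWithBlocks k u w)
startsWithBlocks? zero    u w = yes tt
startsWithBlocks? (suc k) u w =
  take (length u) w ↭? u ×-dec startsWithBlocks? k u (drop (length u) w)

blocks : ∀ k {u w} → StartsWithBlocks k u w →
         ∃[ v ] (∀ (i : Fin k) → v i ↭ u) × Prefix _≡_ (concat (tabulate v)) w
blocks zero            _          = (λ ()) , (λ ()) , []
blocks (suc k) {u} {w} (w↭u , sw) with blocks k sw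
... | v , v↭u , p =
  take (length u) w Vector.∷ v ,
  (λ { zero → w↭u ; (suc i) → v↭u i }) ,
  subst (Prefix _≡_ _) (take++drop≡id (length u) w) (Prefix-++⁺ (take (length u) w) p)

startsWithBlocks : ∀ {k u w} (v : Fin k → Word) → (∀ i → v i ↭ u) →
                   Prefix _≡_ (concat (tabulate v)) w → StartsWithBlocks k u w
startsWithBlocks {zero}          v v↭u p = tt
startsWithBlocks {suc k} {u} {w} v v↭u p with Prefix-++⁻ (v zero) p
-- Turns the cut at `length u` into a cut at the length of the actual first block.
... | eq , q rewrite sym (↭-length (v↭u zero)) =
  ↭-trans (↭-reflexive eq) (v↭u zero) ,
  startsWithBlocks (λ i → v (suc i)) (λ i → v↭u (suc i)) q

-- The blocks have length n + 1.
StartsWithPower : ℕ → Word → Set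
StartsWithPower k w = ∃[ n ] n < length w × StartsWithBlocks k (take (suc n) w) w

startsWithPower? : ∀ k → Decidable (StartsWithPower k)
startsWithPower? k w = anyUpTo? (λ n → startsWithBlocks? k (take (suc n) w) w) (length w)

StartsWithPower⇒ContainsAbelianPower :
  ∀ {k w} → Any (StartsWithPower k) (tails w) → ContainsAbelianPower k w
StartsWithPower⇒ContainsAbelianPower {k} s with Any-tails⇒Infix s
-- The bound `n < length w` excludes the empty suffix. Hence the reference block
-- `take (suc n) (x ∷ xs)` begins with `x`, and no block permuting it is empty.
... | x ∷ xs , (n , _ , sw) , inf with blocks k sw
... | v , v↭u , p =
  v ,
  (λ i v≡[] → contradiction (↭-empty-inv (subst (_ ↭_) v≡[] (↭-sym (v↭u i)))) λ ()) ,
  (λ i j → ↭-trans (v↭u i) (↭-sym (v↭u j))) ,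
  inf p

StartsWithBlocks⇒StartsWithPower : ∀ {k u w} → u ≢ [] → take (length u) w ≡ u →
                                   StartsWithBlocks k u w → StartsWithPower k w
StartsWithBlocks⇒StartsWithPower {u = []}             u≢[] eq sw = contradiction refl u≢[]
StartsWithBlocks⇒StartsWithPower {k} {x ∷ xs} {w} u≢[] eq sw =
  length xs ,
  ℕ.m⊓n≡m⇒m≤n (trans (sym (length-take (suc (length xs)) w)) (cong length eq)) ,
  subst (λ u → StartsWithBlocks k u w) (sym eq) sw

-- The exponent is positive, so `v zero` exists and can serve as the reference block. It is a
-- literal prefix of the suffix, hence determined by its length.
ContainsAbelianPower⇒StartsWithPower :
  ∀ {k w} → ContainsAbelianPower (suc k) w → Any (StartsWithPower (suc k)) (tails w)
ContainsAbelianPower⇒StartsWithPower (v , v≢[] , v↭v , inf) =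
  Any.map
    (λ p → StartsWithBlocks⇒StartsWithPower (v≢[] zero)
             (proj₁ (Prefix-++⁻ (v zero) p))
             (startsWithBlocks v (λ i → v↭v i zero) p))
    (Infix⇒Any-Prefix-tails inf)

-- Defined as a datatype because the unfolding of a recursively defined Set
-- would have size exponential in n.
data Unavoidable (P : Pred Word 0ℓ) : ℕ → Word → Set where
  found : ∀ {n u} → P u → Unavoidable P n u
  grow  : ∀ {n u} → Unavoidable P n (a ∷ u) → Unavoidable P n (b ∷ u) →
          Unavoidable P (suc n) u

module _ {P : Pred Word 0ℓ} where

  unavoidable? : Decidable P → ∀ n u → Dec (Unavoidable P n u)
  unavoidable? P? zero    u = map′ found (λ { (found p) → p }) (P? u)
  unavoidable? P? (suc n) u =
    map′ (λ { (inj₁ p) → found p ; (inj₂ (p , q)) → grow p q })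
         (λ { (found p) → inj₁ p ; (grow p q) → inj₂ (p , q) })
         -- `P? u` comes first: when it succeeds, lazy evaluation leaves both subtrees unexplored.
         -- This is the pruning.
         (P? u ⊎-dec (unavoidable? P? n (a ∷ u) ×-dec unavoidable? P? n (b ∷ u)))

  -- The tree grows words to the left, so `w` lists letters in the order they are prepended and
  -- `w ʳ++ u` is the word reached. Letters left over when `P` is found only go further left,
  -- keeping `u` as a suffix.
  unavoidable-ʳ++ : ∀ {n u} → Unavoidable P n u →
                    ∀ w → length w ≡ n → Any P (tails (w ʳ++ u))
  unavoidable-ʳ++ (found p)  w       eq = Any-tails-ʳ++ w (here p)
  unavoidable-ʳ++ (grow p q) (a ∷ w) eq = unavoidable-ʳ++ p w (suc-injective eq)
  unavoidable-ʳ++ (grow p q) (b ∷ w) eq = unavoidable-ʳ++ q w (suc-injective eq)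

  unavoidable : ∀ {n} → Unavoidable P n [] → ∀ w → length w ≡ n → Any P (tails w)
  unavoidable p w eq =
    subst (λ x → Any P (tails x))
      (trans (ʳ++-defn (reverse w)) (trans (++-identityʳ _) (reverse-involutive w)))
      (unavoidable-ʳ++ p (reverse w) (trans (length-reverse w) eq))

-- Only the start of the word is tested: its proper suffixes are its ancestors in the search tree.
Forbidden : Word → Set
Forbidden w = Prefix _≡_ bb w ⊎ StartsWithPower 4 w

forbidden? : Decidable Forbidden
forbidden? w = prefix? _≟_ bb w ⊎-dec startsWithPower? 4 w

forbidden-unavoidable : Unavoidable Forbidden 18 []
-- The whole search runs during type checking: `from-yes` yields the proof only if the decision
-- evaluates to yes.
forbidden-unavoidable = from-yes (unavoidable? forbidden? 18 [])

proposition4p1 : (∀ (w : Word) → length w ≡ 18 → ¬ (bb IsFactorOf w) → ContainsAbelianPower 4 w)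
    × (length extremalWord ≡ 17
    × ¬ (bb IsFactorOf extremalWord)
    × ¬ ContainsAbelianPower 4 extremalWord)
proposition4p1 =
  binary18 ,
  refl ,
  from-no (infix? _≟_ bb extremalWord) ,
  λ p → from-no (any? (startsWithPower? 4) (tails extremalWord))
          (ContainsAbelianPower⇒StartsWithPower p)
  where
  binary18 : ∀ w → length w ≡ 18 → ¬ (bb IsFactorOf w) → ContainsAbelianPower 4 w
  binary18 w |w|≡18 ¬bb
    with Any-⊎⁻ (unavoidable forbidden-unavoidable w |w|≡18)
  ... | inj₂ power = StartsWithPower⇒ContainsAbelianPower power
  ... | inj₁ bbs with Any-tails⇒Infix bbs
  ...   | _ , p , inf = contradiction (inf p) ¬bb
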